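{- Let $(G;+,\cdot)$ be a nonassociative right semiring, $n \geq 4$, and let $f, g \colon G^n \to G$ be affine functions over $(G;+,\cdot)$. If $f$ and $g$ are both linear, or if $(G;+,\cdot)$ is cancellative, then $\operatorname{deck} f = \operatorname{deck} g$ if and only if $f \equiv g$. In particular, the class of linear functions of arity at least $4$ over any nonassociative right semiring is weakly reconstructible, and if the semiring is cancellative, the class of affine functions of arity at least $4$ over it is weakly reconstructible.
   Context: A nonassociative right semiring is an algebra $(G;+,\cdot)$ such that $(G;+)$ is a commutative monoid with neutral element $0$; $(G;\cdot)$ is a groupoid (not necessarily associative) with right identity $1$; $(a+b)c = ac+bc$; and $a\cdot 0 = 0$. It is cancellative if $a+b=a+c$ implies $b=c$. A function $f\colon G^n\to G$ is affine if $f(x_1,\dots,x_n) = a_1x_1+\dots+a_nx_n+c$ for some $a_i,c\in G$; linear if this holds with $c=0$. Identification minor: for $f\colon A^n\to B$ and $I=\{i,j\}$, $i<j$, $f_I\colon A^{n-1}\to B$ is $f_I(x_1,\dots,x_{n-1}) = f(x_1,\dots,x_{j-1},x_i,x_j,\dots,x_{n-1})$. Two functions $f,g\colon A^n\to B$ are equivalent, $f\equiv g$, if $f(x_1,\dots,x_n) = g(x_{\sigma(1)},\dots,x_{\sigma(n)})$ for some permutation $\sigma$ of $\{1,\dots,n\}$. The deck of $f$ is the multiset $\langle f_I/{\equiv} : I \in \binom{[n]}{2}\rangle$ of equivalence classes of its $\binom n2$ identification minors. A class $\mathcal{C}$ of functions is weakly reconstructible if for every $f\in\mathcal{C}$, every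 $g \in \mathcal{C}$ of the same arity with $\operatorname{deck} g = \operatorname{deck} f$ satisfies $g \equiv f$. -}

module Defs where

open import Level using (Level; _⊔_) renaming (suc to lsuc)
open import Algebra.Core using (Op₂)
open import Algebra.Bundles using (CommutativeMonoid)
import Algebra.Definitions as AlgDefs
import Algebra.Definitions.RawMonoid as RawMonoidDefs
open import Data.Fin.Base using (Fin; zero; suc; Fin′; inject!)
open import Data.Fin.Permutation using (Permutation′; _⟨$⟩ʳ_)
open import Data.Nat.Base using (ℕ; zero; suc; pred; _≥_)
open import Data.Product using (Σ-syntax; ∃-syntax; _×_; _,_)
open import Data.Vec.Functional using (Vector; insertAt; rearrange; zipWith)
import Data.Vec.Functional.Relation.Binary.Equality.Setoid as VecEq
open import Function.Bundles using (Func; _↔_; module Inverse; _⟨$⟩_)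
open import Relation.Binary.Bundles using (Setoid)
open import Relation.Binary.Core using (Rel)
open import Algebra.Structures using (IsCommutativeMonoid)

private variable
  a b c ℓ ℓ₁ ℓ₂ i j p r : Level

record IsNonassociativeRightSemiring {A : Set a} (_≈_ : Rel A ℓ)
         (_+_ _*_ : Op₂ A) (0# 1# : A) : Set (a ⊔ ℓ) where
  open AlgDefs _≈_
  field
    +-isCommutativeMonoid : IsCommutativeMonoid _≈_ _+_ 0#
    *-cong                : Congruent₂ _*_
    *-identityʳ           : RightIdentity 1# _*_
    distribʳ              : _*_ DistributesOverʳ _+_
    zeroʳ                 : RightZero 0# _*_

record NonassociativeRightSemiring c ℓ : Set (lsuc (c ⊔ ℓ)) where
  infixl 7 _*_
  infixl 6 _+_
  infix  4 _≈_
  field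
    Carrier : Set c
    _≈_     : Rel Carrier ℓ
    _+_     : Op₂ Carrier
    _*_     : Op₂ Carrier
    0#      : Carrier
    1#      : Carrier
    isNonassociativeRightSemiring :
      IsNonassociativeRightSemiring _≈_ _+_ _*_ 0# 1#

  open IsNonassociativeRightSemiring isNonassociativeRightSemiring public

  +-commutativeMonoid : CommutativeMonoid c ℓ
  +-commutativeMonoid = record { isCommutativeMonoid = +-isCommutativeMonoid }

  open CommutativeMonoid +-commutativeMonoid public
    using (setoid) renaming (rawMonoid to +-rawMonoid)

  open RawMonoidDefs +-rawMonoid public using (sum)

  +-Cancellative : Set (c ⊔ ℓ)
  +-Cancellative = AlgDefs.LeftCancellative _≈_ _+_

-- Multisets ⟨ x k : k ∈ I ⟩ are given by indexed families. Two of them are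
-- equal, as multisets of ∼-classes, when some bijection of the index sets
-- matches entries up to ∼.

SameMultiset : {X : Set a} → Rel X r → {I : Set i} {J : Set j} →
               (I → X) → (J → X) → Set (r ⊔ i ⊔ j)
SameMultiset _∼_ {I} {J} x y =
  Σ[ φ ∈ I ↔ J ] (∀ k → x k ∼ y (Inverse.to φ k))

-- The two-element subsets {i < j} of Fin n: the larger element j, together
-- with an element i of Fin′ j, the type of those elements of Fin n below j.

Pair : ℕ → Set
Pair n = Σ[ j ∈ Fin n ] Fin′ j

module _ (A : Setoid a ℓ₁) (B : Setoid b ℓ₂) where

  private
    module A = Setoid A
    module B = Setoid B
  open VecEq A using (_≋_; ≋-setoid)

  Fun : ℕ → Set (a ⊔ b ⊔ ℓ₁ ⊔ ℓ₂)
  Fun n = Func (≋-setoid n) B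

  infix 4 _≃_
  _≃_ : ∀ {n} → Rel (Fun n) (a ⊔ ℓ₂)
  _≃_ {n} f g =
    Σ[ σ ∈ Permutation′ n ] (∀ x → (f ⟨$⟩ x) B.≈ (g ⟨$⟩ rearrange (σ ⟨$⟩ʳ_) x))

  insertAt-cong : ∀ {n} {x y : Vector A.Carrier n} {u v} (k : Fin (suc n)) →
                  x ≋ y → u A.≈ v → insertAt x k u ≋ insertAt y k v
  insertAt-cong             zero    x≋y u≈v zero    = u≈v
  insertAt-cong             zero    x≋y u≈v (suc l) = x≋y l
  insertAt-cong {n = suc n} (suc k) x≋y u≈v zero    = x≋y zero
  insertAt-cong {n = suc n} (suc k) x≋y u≈v (suc l) =
    insertAt-cong k (λ m → x≋y (suc m)) u≈v l

  -- f_I (x₁ , … , xₙ₋₁) = f (x₁ , … , xⱼ₋₁ , xᵢ , xⱼ , … , xₙ₋₁) for I = {i < j};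
  -- inject! sends i to the index with the same value in Fin (n - 1).

  minor : ∀ {n} → Fun n → Pair n → Fun (pred n)
  minor {suc n} f (j , i) = record
    { to   = λ x → f ⟨$⟩ insertAt x j (x (inject! i))
    ; cong = λ x≋y → Func.cong f (insertAt-cong j x≋y (x≋y (inject! i)))
    }

  deck : ∀ {n} → Fun n → Pair n → Fun (pred n)
  deck = minor

  SameDeck : ∀ {n} → Rel (Fun n) (a ⊔ ℓ₂)
  SameDeck f g = SameMultiset _≃_ (deck f) (deck g)

  WeaklyReconstructible : (∀ {n} → Fun n → Set p) → Set (a ⊔ b ⊔ ℓ₁ ⊔ ℓ₂ ⊔ p)
  WeaklyReconstructible C =
    ∀ {n} (f : Fun n) → C f → (g : Fun n) → C g → SameDeck g f → g ≃ f

module _ (R : NonassociativeRightSemiring c ℓ) where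

  open NonassociativeRightSemiring R

  Op : ℕ → Set (c ⊔ ℓ)
  Op = Fun setoid setoid

  affineForm : ∀ {n} → Vector Carrier n → Carrier → Vector Carrier n → Carrier
  affineForm α γ x = sum (zipWith _*_ α x) + γ

  Affine : ∀ {n} → Op n → Set (c ⊔ ℓ)
  Affine f = ∃[ α ] ∃[ γ ] (∀ x → (f ⟨$⟩ x) ≈ affineForm α γ x)

  Linear : ∀ {n} → Op n → Set (c ⊔ ℓ)
  Linear f = ∃[ α ] (∀ x → (f ⟨$⟩ x) ≈ affineForm α 0# x)

  Linear≥4 : ∀ {n} → Op n → Set (c ⊔ ℓ)
  Linear≥4 {n} f = n ≥ 4 × Linear f

  Affine≥4 : ∀ {n} → Op n → Set (c ⊔ ℓ)
  Affine≥4 {n} f = n ≥ 4 × Affine f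

{-# OPTIONS --safe #-}

-- Evaluating at 0 and at the unit vectors turns equivalence of functions into equality of constants
-- and of multisets of coefficients. The coefficients of the minors are the cards: the multisets
-- obtained from that of f by replacing two elements by their sum.
--
-- For labels with decidable equality, count how often a label z occurs in all cards together:
-- (n-1 choose 2) times its multiplicity plus the number of pairs with sum z. Split two multisets
-- with the same deck into their common part and disjoint remainders of size k; pairs inside the
-- common part contribute equally to both counts, so k (n-1 choose 2) is at most the number of
-- remaining pairs. For n ≥ 4 this forces k = 0, or n = 4 and k = 1. In the latter case the multisets
-- are {u,v,w,a} and {u,v,w,b} with x + a = b and x + b = a for x = u, v, w; as every card has the
-- sum of the whole multiset, b = u + v + w + a = u + v + w + b = a.
--
-- Equality in the semiring is not decidable, so the entries and their pairwise sums get labels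
-- such that equal labels imply equal values. If the labels do not satisfy what the counting uses
-- (the deck equations, commutativity, congruence), this exhibits an equation that merges two labels.

module Submission where

open import Defs
open import Level using (Level; _⊔_)
open import Algebra.Bundles using (CommutativeMonoid)
import Algebra.Properties.CommutativeMonoid.Sum as MonoidSum
open import Data.Bool.Base using (if_then_else_)
open import Data.Fin.Base using (Fin; zero; suc; inject!; punchIn; punchOut; splitAt)
import Data.Fin.Base as Fin
open import Data.Fin.Permutation using (Permutation; Permutation′; permutation; _⟨$⟩ʳ_; _⟨$⟩ˡ_; _∘ₚ_; flip; inverseˡ; inverseʳ; cast-id)
import Data.Fin.Properties as Finₚ
open import Data.List.Base using (List; []; _∷_; map; tabulate; length; lookup; foldr) renaming (_++_ to _++ₗ_)
import Data.List.Properties as Listₚ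
import Data.List.Relation.Binary.Permutation.Homogeneous as Homogeneous
import Data.List.Relation.Binary.Permutation.Setoid as SetoidPermutation
import Data.List.Relation.Binary.Permutation.Setoid.Properties as SetoidPermutationₚ
open import Data.List.Relation.Binary.Pointwise.Base using (Pointwise; []; _∷_)
open import Data.Nat.Base using (ℕ; zero; suc; _+_; _*_; _≤_; _≥_; z≤n; s≤s)
import Data.Nat.Properties as ℕ
open import Data.Nat.Tactic.RingSolver using (solve-∀)
open import Data.Product using (Σ-syntax; ∃; ∃-syntax; _×_; _,_; proj₁; proj₂)
open import Data.Sum.Base using (_⊎_; inj₁; inj₂; [_,_])
import Data.Sum.Base as Sum
open import Data.Sum.Function.Propositional using (_⊎-↔_)
open import Data.Vec.Functional using (Vector; insertAt; removeAt; updateAt; rearrange; zipWith)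
import Data.Vec.Functional.Properties as Vectorₚ
open import Data.Product.Function.NonDependent.Propositional using (_×-↔_)
open import Data.Unit.Base using (⊤; tt)
open import Function.Base using (_∘_; const; id)
open import Function.Bundles using (Func; _↔_; _⇔_; mk⇔; mk↔ₛ′; module Inverse; _⟨$⟩_)
open import Function.Construct.Composition using (_↔-∘_)
open import Function.Construct.Identity using (↔-id)
open import Function.Construct.Symmetry using (↔-sym)
open import Relation.Binary.Bundles using (Setoid)
open import Relation.Binary.Definitions using (tri<; tri≈; tri>)
import Relation.Binary.Construct.On as On
open import Relation.Binary.PropositionalEquality
  using (_≡_; _≢_; refl; sym; trans; cong; cong₂; subst; subst₂; module ≡-Reasoning)
import Relation.Binary.PropositionalEquality.Properties as ≡ₚ
open import Relation.Nullary using (Dec; yes; no; does; ¬_; contradiction)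
open import Relation.Nullary.Decidable using (map′; _×-dec_; _⊎-dec_; ¬?; decidable-stable; dec-true; dec-false)
open import Relation.Unary using (Decidable)

open MonoidSum ℕ.+-0-commutativeMonoid using () renaming
  (sum to ∑; sum-cong-≗ to ∑-cong; ∑-distrib-+ to ∑-+; sum-permute to ∑-permute; sum-remove to ∑-remove)

private variable
  a b c p ℓ ℓ₁ ℓ₂ : Level
  A W : Set a
  m n : ℕ

-- Pairs of indices

hi : Pair n → Fin n
hi = proj₁

-- As `i` lies below `j`, `punchIn j` keeps its value. In this form `removeAt w j (inject! i)` is
-- `w (lo (j , i))` by definition.
lo : Pair n → Fin n
lo {suc n} (j , i) = punchIn j (inject! i)

lo≢hi : (p : Pair n) → lo p ≢ hi p
lo≢hi {suc n} (j , i) = Finₚ.punchInᵢ≢i j (inject! i)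

lo<hi : (p : Pair n) → lo p Fin.< hi p
lo<hi {suc (suc n)} (suc j , zero)  = s≤s z≤n
lo<hi {suc (suc n)} (suc j , suc i) = s≤s (lo<hi (j , i))

shift : Pair n → Pair (suc n)
shift (j , i) = suc j , suc i

lo-shift : (p : Pair n) → lo (shift p) ≡ suc (lo p)
lo-shift {suc n} (j , i) = refl

hi-lo-injective : (p q : Pair n) → hi p ≡ hi q → lo p ≡ lo q → p ≡ q
hi-lo-injective {suc n} (j , i) (.j , i′) refl eq =
  cong (j ,_) (Finₚ.inject!-injective (Finₚ.punchIn-injective j _ _ eq))

-- Unordered, because a permutation may reverse the order of the endpoints.
Joins : Pair n → Fin n → Fin n → Set
Joins p x y = (hi p ≡ x × lo p ≡ y) ⊎ (hi p ≡ y × lo p ≡ x)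

pair-below : {y x : Fin n} → y Fin.< x → Σ[ p ∈ Pair n ] (hi p ≡ x × lo p ≡ y)
pair-below {suc (suc n)} {zero}  {suc x} _ = (suc x , zero) , refl , refl
pair-below {suc n} {suc y} {suc x} (s≤s y<x) with pair-below y<x
... | p , refl , refl = shift p , refl , lo-shift p

join : (x y : Fin n) → x ≢ y → Σ[ p ∈ Pair n ] Joins p x y
join x y x≢y with Finₚ.<-cmp x y
... | tri< x<y _ _ = proj₁ (pair-below x<y) , inj₂ (proj₂ (pair-below x<y))
... | tri≈ _ x≡y _ = contradiction x≡y x≢y
... | tri> _ _ y<x = proj₁ (pair-below y<x) , inj₁ (proj₂ (pair-below y<x))

Joins-unique : ∀ {p q : Pair n} {x y} → Joins p x y → Joins q x y → p ≡ q
Joins-unique {p = p} {q} (inj₁ (refl , refl)) (inj₁ (e , f)) = hi-lo-injective p q (sym e) (sym f)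
Joins-unique {p = p} {q} (inj₂ (refl , refl)) (inj₂ (e , f)) = hi-lo-injective p q (sym e) (sym f)
Joins-unique {p = p} {q} (inj₁ (refl , refl)) (inj₂ (e , f)) =
  contradiction (lo<hi p) (Finₚ.<-asym (subst₂ Fin._<_ f e (lo<hi q)))
Joins-unique {p = p} {q} (inj₂ (refl , refl)) (inj₁ (e , f)) =
  contradiction (lo<hi p) (Finₚ.<-asym (subst₂ Fin._<_ f e (lo<hi q)))

-- The map on pairs induced by a permutation

permutation-injective : (σ : Permutation m n) → ∀ {x y} → σ ⟨$⟩ʳ x ≡ σ ⟨$⟩ʳ y → x ≡ y
permutation-injective σ {x} {y} eq = trans (sym (inverseˡ σ)) (trans (cong (σ ⟨$⟩ˡ_) eq) (inverseˡ σ))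

module _ (σ : Permutation′ n) where

  private
    image-joins : (p : Pair n) → Σ[ q ∈ Pair n ] Joins q (σ ⟨$⟩ʳ hi p) (σ ⟨$⟩ʳ lo p)
    image-joins p = join _ _ (lo≢hi p ∘ sym ∘ permutation-injective σ)

  image : Pair n → Pair n
  image = proj₁ ∘ image-joins

  joins-image : (p : Pair n) → Joins (image p) (σ ⟨$⟩ʳ hi p) (σ ⟨$⟩ʳ lo p)
  joins-image = proj₂ ∘ image-joins

image-preserves-joins : (σ : Permutation′ n) (p : Pair n) {x y : Fin n} →
                        Joins p x y → Joins (image σ p) (σ ⟨$⟩ʳ x) (σ ⟨$⟩ʳ y)
image-preserves-joins σ p (inj₁ (refl , refl)) = joins-image σ p
image-preserves-joins σ p (inj₂ (refl , refl)) = Sum.swap (joins-image σ p)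

image-flip : (σ : Permutation′ n) (p : Pair n) → image σ (image (flip σ) p) ≡ p
image-flip σ p = Joins-unique
  (subst₂ (Joins (image σ (image (flip σ) p))) (inverseʳ σ) (inverseʳ σ)
    (image-preserves-joins σ (image (flip σ) p) (joins-image (flip σ) p)))
  (inj₁ (refl , refl))

image-↔ : Permutation′ n → Pair n ↔ Pair n
image-↔ σ = mk↔ₛ′ (image σ) (image (flip σ)) (image-flip σ) (image-flip (flip σ))

-- Equivalent functions have the same deck

-- The quotient map that identifies the two elements of the pair: the minor at `p` evaluates its
-- function at `x ∘ collapse p`.
collapse : Pair (suc n) → Fin (suc n) → Fin n
collapse (j , i) l with j Finₚ.≟ l
... | yes _   = inject! i
... | no  j≢l = punchOut j≢l

collapse-punchIn : (p : Pair (suc n)) (k : Fin n) → collapse p (punchIn (hi p) k) ≡ k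
collapse-punchIn (j , i) k with j Finₚ.≟ punchIn j k
... | yes eq  = contradiction (sym eq) (Finₚ.punchInᵢ≢i j k)
... | no  _   = trans (Finₚ.punchOut-cong j refl) (Finₚ.punchOut-punchIn j)

-- Universal property of the quotient: the section `punchIn (hi p)` misses only `hi p`, where `h`
-- takes the same value as at `lo p`.
factors-through-collapse : (p : Pair (suc n)) (h : Fin (suc n) → A) → h (hi p) ≡ h (lo p) →
                           ∀ l → h (punchIn (hi p) (collapse p l)) ≡ h l
factors-through-collapse (j , i) h eq l with j Finₚ.≟ l
... | yes refl = sym eq
... | no  j≢l  = cong h (Finₚ.punchIn-punchOut j≢l)

collapse-hi : (p : Pair (suc n)) → collapse p (hi p) ≡ collapse p (lo p)
collapse-hi p@(j , i) with j Finₚ.≟ j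
... | yes _  = sym (collapse-punchIn p (inject! i))
... | no j≢j = contradiction refl j≢j

collapse-identifies : (p : Pair (suc n)) {x y : Fin (suc n)} → Joins p x y →
                      collapse p x ≡ collapse p y
collapse-identifies p (inj₁ (refl , refl)) = collapse-hi p
collapse-identifies p (inj₂ (refl , refl)) = sym (collapse-hi p)

insertAt-collapse : (p : Pair (suc n)) (x : Vector A n) → ∀ l →
                    insertAt x (hi p) (x (inject! (proj₂ p))) l ≡ x (collapse p l)
insertAt-collapse p@(j , i) x l with j Finₚ.≟ l
... | yes refl = Vectorₚ.insertAt-lookup x j _
... | no  j≢l  = trans
  (cong (insertAt x j _) (sym (Finₚ.punchIn-punchOut j≢l)))
  (Vectorₚ.insertAt-punchIn x j _ _)

module _ (σ : Permutation′ (suc n)) (p : Pair (suc n)) where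

  private
    q : Pair (suc n)
    q = image (flip σ) p

    σ-joins : Joins p (σ ⟨$⟩ʳ hi q) (σ ⟨$⟩ʳ lo q)
    σ-joins = subst (λ p → Joins p (σ ⟨$⟩ʳ hi q) (σ ⟨$⟩ʳ lo q)) (image-flip σ p) (joins-image σ q)

    to : Fin n → Fin n
    to k = collapse p (σ ⟨$⟩ʳ punchIn (hi q) k)

    from : Fin n → Fin n
    from k = collapse q (σ ⟨$⟩ˡ punchIn (hi p) k)

  -- As `σ` carries `q` to `p`, following it by `collapse p` identifies the elements of `q`, so it
  -- descends along `collapse q`. The inverse of `σ` descends likewise, and the two induced maps are
  -- mutually inverse.
  collapse-square : ∀ l → to (collapse q l) ≡ collapse p (σ ⟨$⟩ʳ l)
  collapse-square = factors-through-collapse q (collapse p ∘ (σ ⟨$⟩ʳ_))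
    (collapse-identifies p σ-joins)

  private
    collapse-square⁻¹ : ∀ l → from (collapse p l) ≡ collapse q (σ ⟨$⟩ˡ l)
    collapse-square⁻¹ = factors-through-collapse p (collapse q ∘ (σ ⟨$⟩ˡ_))
      (collapse-identifies q (joins-image (flip σ) p))

  quotient-permutation : Permutation′ n
  quotient-permutation = permutation to from
    (λ k → trans (collapse-square _)
             (trans (cong (collapse p) (inverseʳ σ)) (collapse-punchIn p k)))
    (λ k → trans (collapse-square⁻¹ _)
             (trans (cong (collapse q) (inverseˡ σ)) (collapse-punchIn q k)))

module _ (S : Setoid a ℓ₁) (T : Setoid b ℓ₂) where

  private
    module S = Setoid S
    module T = Setoid T

  -- With `q` the preimage of `p` under `σ`, the chain is `f (x ∘ collapse p) = g (x ∘ collapse p ∘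
  -- σ) = g (x ∘ τ ∘ collapse q)`.
  ≃⇒minor-≃ : (f g : Fun S T (suc n)) ((σ , _) : _≃_ S T f g) →
              ∀ p → _≃_ S T (minor S T f p) (minor S T g (image (flip σ) p))
  ≃⇒minor-≃ f g (σ , f≈g) p = τ , λ x →
    T.trans (Func.cong f (S.reflexive ∘ insertAt-collapse p x))
      (T.trans (f≈g (x ∘ collapse p))
        (Func.cong g λ l → S.reflexive (sym
          (trans (insertAt-collapse (image (flip σ) p) (x ∘ (τ ⟨$⟩ʳ_)) l)
            (cong x (collapse-square σ p l))))))
    where τ = quotient-permutation σ p

  ≃⇒SameDeck : (f g : Fun S T n) → _≃_ S T f g → SameDeck S T f g
  ≃⇒SameDeck {n = zero}  f g (σ , _) = image-↔ σ , λ ()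
  ≃⇒SameDeck {n = suc n} f g f≃g@(σ , _) = image-↔ (flip σ) , ≃⇒minor-≃ f g f≃g

-- Sums over pairs

-- The binomial coefficient (n choose 2), the number of pairs in `Fin n`.
tri : ℕ → ℕ
tri zero    = zero
tri (suc n) = n + tri n

-- Splitting off the pairs that contain `zero` allows induction on `n`.
∑ₚ : ∀ n → (Pair n → ℕ) → ℕ
∑ₚ zero    F = 0
∑ₚ (suc n) F = ∑ (λ j → F (suc j , zero)) + ∑ₚ n (F ∘ shift)

pairs-suc : (Fin n ⊎ Pair n) ↔ Pair (suc n)
pairs-suc {n} = mk↔ₛ′ to from to∘from from∘to
  where
  to : Fin n ⊎ Pair n → Pair (suc n)
  to = [ (λ j → suc j , zero) , shift ]
  from : Pair (suc n) → Fin n ⊎ Pair n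
  from (suc j , zero)  = inj₁ j
  from (suc j , suc i) = inj₂ (j , i)
  to∘from : ∀ p → to (from p) ≡ p
  to∘from (suc j , zero)  = refl
  to∘from (suc j , suc i) = refl
  from∘to : ∀ p → from (to p) ≡ p
  from∘to (inj₁ j) = refl
  from∘to (inj₂ p) = refl

pairs-enumeration : ∀ n → Fin (tri n) ↔ Pair n
pairs-enumeration zero    = mk↔ₛ′ (λ ()) (λ ()) (λ ()) (λ ())
pairs-enumeration (suc n) = pairs-suc ↔-∘ ((↔-id (Fin n) ⊎-↔ pairs-enumeration n) ↔-∘ Finₚ.+↔⊎)

∑-splitAt : ∀ m (F : Fin m ⊎ Fin n → ℕ) → ∑ (F ∘ splitAt m) ≡ ∑ (F ∘ inj₁) + ∑ (F ∘ inj₂)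
∑-splitAt zero    F = refl
∑-splitAt (suc m) F = trans (cong (F (inj₁ zero) +_) (∑-splitAt m (F ∘ Sum.map₁ suc)))
                            (sym (ℕ.+-assoc (F (inj₁ zero)) _ _))

∑ₚ-enumeration : ∀ n (F : Pair n → ℕ) → ∑ₚ n F ≡ ∑ (F ∘ Inverse.to (pairs-enumeration n))
∑ₚ-enumeration zero    F = refl
∑ₚ-enumeration (suc n) F = begin
  ∑ (F ∘ to ∘ inj₁) + ∑ₚ n (F ∘ shift)
    ≡⟨ cong (∑ (F ∘ to ∘ inj₁) +_) (∑ₚ-enumeration n (F ∘ shift)) ⟩
  ∑ (F ∘ to ∘ inj₁) + ∑ (F ∘ shift ∘ e)
    ≡⟨ ∑-splitAt n (F ∘ to ∘ Sum.map id e) ⟨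
  ∑ (F ∘ to ∘ Sum.map id e ∘ splitAt n) ∎
  where
  open ≡-Reasoning
  to = Inverse.to pairs-suc
  e  = Inverse.to (pairs-enumeration n)

-- Conjugating `φ` with the enumeration of pairs gives a permutation of `Fin (tri n)`, under which
-- ordinary sums are invariant.
∑ₚ-permute : (φ : Pair n ↔ Pair n) (F : Pair n → ℕ) → ∑ₚ n (F ∘ Inverse.to φ) ≡ ∑ₚ n F
∑ₚ-permute {n} φ F = begin
  ∑ₚ n (F ∘ Inverse.to φ)     ≡⟨ ∑ₚ-enumeration n (F ∘ Inverse.to φ) ⟩
  ∑ (F ∘ Inverse.to φ ∘ e)    ≡⟨ ∑-cong {tri n} (λ k → cong F (Inverse.strictlyInverseˡ (pairs-enumeration n) (Inverse.to φ (e k)))) ⟨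
  ∑ (F ∘ e ∘ (π ⟨$⟩ʳ_))       ≡⟨ ∑-permute (F ∘ e) π ⟨
  ∑ (F ∘ e)                   ≡⟨ ∑ₚ-enumeration n F ⟨
  ∑ₚ n F                      ∎
  where
  open ≡-Reasoning
  e = Inverse.to (pairs-enumeration n)
  π = ↔-sym (pairs-enumeration n) ↔-∘ (φ ↔-∘ pairs-enumeration n)

∑ₚ-cong : ∀ n {F G : Pair n → ℕ} → (∀ p → F p ≡ G p) → ∑ₚ n F ≡ ∑ₚ n G
∑ₚ-cong zero    F≗G = refl
∑ₚ-cong (suc n) F≗G = cong₂ _+_ (∑-cong (λ j → F≗G (suc j , zero))) (∑ₚ-cong n (F≗G ∘ shift))

∑ₚ-+ : ∀ n (F G : Pair n → ℕ) → ∑ₚ n (λ p → F p + G p) ≡ ∑ₚ n F + ∑ₚ n G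
∑ₚ-+ zero    F G = refl
∑ₚ-+ (suc n) F G = trans
  (cong₂ _+_ (∑-+ (λ j → F (suc j , zero)) (λ j → G (suc j , zero))) (∑ₚ-+ n (F ∘ shift) (G ∘ shift)))
  (interchange (∑ λ j → F (suc j , zero)) (∑ λ j → G (suc j , zero)) (∑ₚ n (F ∘ shift)) (∑ₚ n (G ∘ shift)))
  where
  interchange : ∀ a b c d → a + b + (c + d) ≡ a + c + (b + d)
  interchange = solve-∀

∑-const : ∀ n c → ∑ {n} (const c) ≡ n * c
∑-const zero    c = refl
∑-const (suc n) c = cong (c +_) (∑-const n c)

∑ₚ-const : ∀ n c → ∑ₚ n (const c) ≡ tri n * c
∑ₚ-const zero    c = refl
∑ₚ-const (suc n) c = trans (cong₂ _+_ (∑-const n c) (∑ₚ-const n c)) (sym (ℕ.*-distribʳ-+ c n (tri n)))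

-- Every index lies in n of the pairs of elements of Fin (suc n).
∑ₚ-endpoints : ∀ n (g : Vector ℕ (suc n)) → ∑ₚ (suc n) (λ p → g (hi p) + g (lo p)) ≡ n * ∑ g
∑ₚ-endpoints zero    g = refl
∑ₚ-endpoints (suc n) g = begin
  ∑ (λ j → g (suc j) + g zero) + ∑ₚ (suc n) (λ p → g (suc (hi p)) + g (lo (shift p)))
    ≡⟨ cong₂ _+_ (∑-+ (g ∘ suc) (const (g zero))) (∑ₚ-cong (suc n) (λ p → cong (λ l → g (suc (hi p)) + g l) (lo-shift p))) ⟩
  ∑ (g ∘ suc) + ∑ {suc n} (const (g zero)) + ∑ₚ (suc n) (λ p → g (suc (hi p)) + g (suc (lo p)))
    ≡⟨ cong₂ _+_ (cong (∑ (g ∘ suc) +_) (∑-const (suc n) (g zero))) (∑ₚ-endpoints n (g ∘ suc)) ⟩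
  ∑ (g ∘ suc) + suc n * g zero + n * ∑ (g ∘ suc)
    ≡⟨ arithmetic n (g zero) (∑ (g ∘ suc)) ⟩
  suc n * (g zero + ∑ (g ∘ suc)) ∎
  where
  open ≡-Reasoning
  arithmetic : ∀ n x s → s + suc n * x + n * s ≡ suc n * (x + s)
  arithmetic = solve-∀

-- Cards

-- Sums stay formal, so that they can receive labels before anything is known about their values.
Term : Set a → Set a
Term W = W ⊎ W × W

-- The coefficients of the identification minor at p, with the merged coefficient as a formal sum.
card : Vector W (suc n) → Pair (suc n) → Vector (Term W) n
card w (j , i) = updateAt (inj₁ ∘ removeAt w j) (inject! i) (const (inj₂ (w (lo (j , i)) , w j)))

module _ {c ℓ} (M : CommutativeMonoid c ℓ) where

  open CommutativeMonoid M renaming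
    (_∙_ to _⊕_; refl to ≈-refl; sym to ≈-sym; trans to ≈-trans; ∙-cong to ⊕-cong; ∙-congˡ to ⊕-congˡ; ∙-congʳ to ⊕-congʳ)
  open MonoidSum M
  open import Algebra.Solver.CommutativeMonoid M using (solve; _⊜_) renaming (_⊕_ to _:+_)

  -- A monoid has no subtraction, so the change of the entry at `i` is balanced by `x` and `y` on
  -- the two sides.
  sum-change : (s t : Vector Carrier n) (i : Fin n) {x y : Carrier} →
               s i ⊕ x ≈ t i ⊕ y → (∀ k → k ≢ i → s k ≈ t k) →
               sum s ⊕ x ≈ sum t ⊕ y
  sum-change {n = suc n} s t i {x} {y} eqᵢ eq = begin
    sum s ⊕ x                      ≈⟨ ⊕-congʳ (sum-remove {i = i} s) ⟩
    s i ⊕ sum (removeAt s i) ⊕ x   ≈⟨ rotate (s i) _ x ⟩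
    s i ⊕ x ⊕ sum (removeAt s i)   ≈⟨ ⊕-cong eqᵢ (sum-cong-≋ (λ k → eq (punchIn i k) (Finₚ.punchInᵢ≢i i k))) ⟩
    t i ⊕ y ⊕ sum (removeAt t i)   ≈⟨ rotate (t i) _ y ⟨
    t i ⊕ sum (removeAt t i) ⊕ y   ≈⟨ ⊕-congʳ (sum-remove {i = i} t) ⟨
    sum t ⊕ y                      ∎
    where
    open import Relation.Binary.Reasoning.Setoid setoid
    rotate : ∀ a b c → a ⊕ b ⊕ c ≈ a ⊕ c ⊕ b
    rotate = solve 3 (λ a b c → (a :+ b) :+ c ⊜ (a :+ c) :+ b) ≈-refl

card-merged : (w : Vector W (suc n)) (p : Pair (suc n)) →
              card w p (inject! (proj₂ p)) ≡ inj₂ (w (lo p) , w (hi p))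
card-merged w (j , i) = Vectorₚ.updateAt-updates (inject! i) (inj₁ ∘ removeAt w j)

card-other : (w : Vector W (suc n)) (p : Pair (suc n)) → ∀ k → k ≢ inject! (proj₂ p) →
             card w p k ≡ inj₁ (removeAt w (hi p) k)
card-other w (j , i) k k≢i = Vectorₚ.updateAt-minimal k (inject! i) (inj₁ ∘ removeAt w j) k≢i

-- A card loses the entries at `hi p` and `lo p` and gains their formal sum; the loss is added on
-- the left to avoid subtraction.
∑-card : (h : Term W → ℕ) (w : Vector W (suc n)) (p : Pair (suc n)) →
         ∑ (h ∘ card w p) + (h (inj₁ (w (hi p))) + h (inj₁ (w (lo p)))) ≡
         ∑ (h ∘ inj₁ ∘ w) + h (inj₂ (w (lo p) , w (hi p)))
∑-card h w p@(j , i) = begin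
  ∑ (h ∘ card w p) + (x + y)   ≡⟨ rotate (∑ (h ∘ card w p)) x y ⟩
  ∑ (h ∘ card w p) + y + x     ≡⟨ cong (_+ x) (sum-change ℕ.+-0-commutativeMonoid (h ∘ card w p) (h ∘ inj₁ ∘ removeAt w j) (inject! i)
                                     (trans (ℕ.+-comm _ y) (cong (λ t → y + h t) (card-merged w p)))
                                     (λ k → cong h ∘ card-other w p k)) ⟩
  ∑ (h ∘ inj₁ ∘ removeAt w j) + z + x ≡⟨ rotate′ (∑ (h ∘ inj₁ ∘ removeAt w j)) z x ⟩
  x + ∑ (h ∘ inj₁ ∘ removeAt w j) + z ≡⟨ cong (_+ z) (∑-remove {i = j} (h ∘ inj₁ ∘ w)) ⟨
  ∑ (h ∘ inj₁ ∘ w) + z         ∎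
  where
  open ≡-Reasoning
  x = h (inj₁ (w (hi p)))
  y = h (inj₁ (w (lo p)))
  z = h (inj₂ (w (lo p) , w (hi p)))
  rotate : ∀ s x y → s + (x + y) ≡ s + y + x
  rotate = solve-∀
  rotate′ : ∀ s z x → s + z + x ≡ x + s + z
  rotate′ = solve-∀

-- Sum `∑-card` over all `n + tri n` pairs. Each entry is lost in `n` of them, so `n * S` cancels
-- and the factor `tri n` remains.
∑-deck : (h : Term W → ℕ) (w : Vector W (suc n)) →
         ∑ₚ (suc n) (λ p → ∑ (h ∘ card w p)) ≡
         tri n * ∑ (h ∘ inj₁ ∘ w) + ∑ₚ (suc n) (λ p → h (inj₂ (w (lo p) , w (hi p))))
∑-deck {n = n} h w = ℕ.+-cancelʳ-≡ (n * S) _ _ (begin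
  ∑ₚ (suc n) (λ p → ∑ (h ∘ card w p)) + n * S
    ≡⟨ cong (∑ₚ (suc n) (λ p → ∑ (h ∘ card w p)) +_) (∑ₚ-endpoints n (h ∘ inj₁ ∘ w)) ⟨
  ∑ₚ (suc n) (λ p → ∑ (h ∘ card w p)) + ∑ₚ (suc n) (λ p → h (inj₁ (w (hi p))) + h (inj₁ (w (lo p))))
    ≡⟨ ∑ₚ-+ (suc n) (λ p → ∑ (h ∘ card w p)) (λ p → h (inj₁ (w (hi p))) + h (inj₁ (w (lo p)))) ⟨
  ∑ₚ (suc n) (λ p → ∑ (h ∘ card w p) + (h (inj₁ (w (hi p))) + h (inj₁ (w (lo p)))))
    ≡⟨ ∑ₚ-cong (suc n) (∑-card h w) ⟩
  ∑ₚ (suc n) (λ p → S + h (inj₂ (w (lo p) , w (hi p))))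
    ≡⟨ ∑ₚ-+ (suc n) (const S) (λ p → h (inj₂ (w (lo p) , w (hi p)))) ⟩
  ∑ₚ (suc n) (const S) + P
    ≡⟨ cong (_+ P) (∑ₚ-const (suc n) S) ⟩
  (n + tri n) * S + P
    ≡⟨ arithmetic n (tri n) S P ⟩
  tri n * S + P + n * S ∎)
  where
  open ≡-Reasoning
  S = ∑ (h ∘ inj₁ ∘ w)
  P = ∑ₚ (suc n) (λ p → h (inj₂ (w (lo p) , w (hi p))))
  arithmetic : ∀ n t s p → (n + t) * s + p ≡ t * s + p + n * s
  arithmetic = solve-∀

-- Sums over lists and over pairs of list entries

∑[] : (A → ℕ) → List A → ℕ
∑[] g []       = 0
∑[] g (x ∷ xs) = g x + ∑[] g xs

∑[]-++ : (g : A → ℕ) → ∀ xs ys → ∑[] g (xs ++ₗ ys) ≡ ∑[] g xs + ∑[] g ys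
∑[]-++ g []       ys = refl
∑[]-++ g (x ∷ xs) ys = trans (cong (g x +_) (∑[]-++ g xs ys)) (sym (ℕ.+-assoc (g x) _ _))

∑[]-tabulate : (g : A → ℕ) (w : Vector A n) → ∑[] g (tabulate w) ≡ ∑ (g ∘ w)
∑[]-tabulate {n = zero}  g w = refl
∑[]-tabulate {n = suc n} g w = cong (g (w zero) +_) (∑[]-tabulate g (w ∘ suc))

∑₂ : (A → A → ℕ) → List A → ℕ
∑₂ h []       = 0
∑₂ h (x ∷ xs) = ∑[] (h x) xs + ∑₂ h xs

∑₂-tabulate : (h : A → A → ℕ) (w : Vector A n) → ∑₂ h (tabulate w) ≡ ∑ₚ n (λ p → h (w (lo p)) (w (hi p)))
∑₂-tabulate {n = zero}  h w = refl
∑₂-tabulate {n = suc n} h w = cong₂ _+_ (row n w) (trans (∑₂-tabulate h (w ∘ suc))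
  (∑ₚ-cong n (λ p → cong (λ l → h (w l) (w (suc (hi p)))) (sym (lo-shift p)))))
  where
  -- The case split on `n` lets `lo (suc j , zero)` reduce to `zero`.
  row : ∀ n (w : Vector _ (suc n)) → ∑[] (h (w zero)) (tabulate (w ∘ suc)) ≡ ∑ {n} (λ j → h (w (lo (suc j , zero))) (w (suc j)))
  row zero    w = refl
  row (suc n) w = ∑[]-tabulate (h (w zero)) (w ∘ suc)

-- The sum over those pairs of entries of N ++ ys that do not lie inside N.
∑₂-outside : (A → A → ℕ) → List A → List A → ℕ
∑₂-outside h []      ys = ∑₂ h ys
∑₂-outside h (x ∷ N) ys = ∑[] (h x) ys + ∑₂-outside h N ys

∑₂-++ : (h : A → A → ℕ) → ∀ N ys → ∑₂ h (N ++ₗ ys) ≡ ∑₂ h N + ∑₂-outside h N ys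
∑₂-++ h []      ys = refl
∑₂-++ h (x ∷ N) ys = trans (cong₂ _+_ (∑[]-++ (h x) N ys) (∑₂-++ h N ys))
  (interchange (∑[] (h x) N) (∑[] (h x) ys) (∑₂ h N) (∑₂-outside h N ys))
  where
  interchange : ∀ a b c d → a + b + (c + d) ≡ a + c + (b + d)
  interchange = solve-∀

module _ {R : A → A → Set} where

  ∑[]-↭ : {g : A → ℕ} → (∀ {x y} → R x y → g x ≡ g y) →
          ∀ {xs ys} → Homogeneous.Permutation R xs ys → ∑[] g xs ≡ ∑[] g ys
  ∑[]-↭ {g} g-cong (Homogeneous.refl xs≋ys) = pointwise xs≋ys
    where
    pointwise : ∀ {xs ys} → Pointwise R xs ys → ∑[] g xs ≡ ∑[] g ys
    pointwise []       = refl
    pointwise (r ∷ rs) = cong₂ _+_ (g-cong r) (pointwise rs)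
  ∑[]-↭ g-cong (Homogeneous.prep r p)     = cong₂ _+_ (g-cong r) (∑[]-↭ g-cong p)
  ∑[]-↭ {g} g-cong (Homogeneous.swap {x′ = x′} {y′ = y′} r s p) =
    trans (cong₂ _+_ (g-cong r) (cong₂ _+_ (g-cong s) (∑[]-↭ g-cong p))) (exchange (g x′) (g y′) _)
    where
    exchange : ∀ a b c → a + (b + c) ≡ b + (a + c)
    exchange = solve-∀
  ∑[]-↭ g-cong (Homogeneous.trans p q)    = trans (∑[]-↭ g-cong p) (∑[]-↭ g-cong q)

  ∑[]-cong : {g g′ : A → ℕ} → (∀ x → g x ≡ g′ x) → ∀ xs → ∑[] g xs ≡ ∑[] g′ xs
  ∑[]-cong eq []       = refl
  ∑[]-cong eq (x ∷ xs) = cong₂ _+_ (eq x) (∑[]-cong eq xs)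

  module _ {h : A → A → ℕ} (h-congˡ : ∀ {x x′} y → R x x′ → h x y ≡ h x′ y)
           (h-comm : ∀ x y → h x y ≡ h y x) where

    private
      h-congʳ : ∀ {y y′} x → R y y′ → h x y ≡ h x y′
      h-congʳ x r = trans (h-comm x _) (trans (h-congˡ x r) (h-comm _ x))

      row : ∀ {x y xs ys} → R x y → Homogeneous.Permutation R xs ys → ∑[] (h x) xs ≡ ∑[] (h y) ys
      row {xs = xs} r p = trans (∑[]-cong (λ z → h-congˡ z r) xs) (∑[]-↭ (h-congʳ _) p)

    -- Swapping two entries reverses the pair that they form, which `h-comm` absorbs; all other
    -- pairs are only reordered.
    ∑₂-↭ : ∀ {xs ys} → Homogeneous.Permutation R xs ys → ∑₂ h xs ≡ ∑₂ h ys
    ∑₂-↭ (Homogeneous.refl xs≋ys) = pointwise xs≋ys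
      where
      pointwise : ∀ {xs ys} → Pointwise R xs ys → ∑₂ h xs ≡ ∑₂ h ys
      pointwise []       = refl
      pointwise (r ∷ rs) = cong₂ _+_ (row r (Homogeneous.refl rs)) (pointwise rs)
    ∑₂-↭ (Homogeneous.prep r p)  = cong₂ _+_ (row r p) (∑₂-↭ p)
    ∑₂-↭ (Homogeneous.swap {ys = ys} {x = x} {y} {x′} {y′} r s p) =
      trans (cong₂ _+_ (cong₂ _+_ xy (row r p)) (cong₂ _+_ (row s p) (∑₂-↭ p)))
            (exchange (h y′ x′) (∑[] (h x′) ys) (∑[] (h y′) ys) (∑₂ h ys))
      where
      xy : h x y ≡ h y′ x′
      xy = trans (h-congˡ y r) (trans (h-congʳ x′ s) (h-comm x′ y′))
      exchange : ∀ a b c d → a + b + (c + d) ≡ a + c + (b + d)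
      exchange = solve-∀
    ∑₂-↭ (Homogeneous.trans p q) = trans (∑₂-↭ p) (∑₂-↭ q)

-- Multiplicities of labels

δ : Fin m → Fin m → ℕ
δ z y = if does (z Finₚ.≟ y) then 1 else 0

δ-refl : (z : Fin m) → δ z z ≡ 1
δ-refl z rewrite dec-true (z Finₚ.≟ z) refl = refl

1≤δ⇒≡ : {y z : Fin m} → 1 ≤ δ z y → z ≡ y
1≤δ⇒≡ {y = y} {z} le with z Finₚ.≟ y
... | yes eq = eq

δ≤1 : (z y : Fin m) → δ z y ≤ 1
δ≤1 z y with z Finₚ.≟ y
... | yes _ = ℕ.≤-refl
... | no  _ = z≤n

∑-zero : ∀ n → ∑ {n} (const 0) ≡ 0
∑-zero n = trans (∑-const n 0) (ℕ.*-zeroʳ n)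

∑-δ : (y : Fin m) → ∑ (λ z → δ z y) ≡ 1
∑-δ {suc m} zero    = cong suc (∑-zero m)
∑-δ {suc m} (suc y) = ∑-δ y

∑-mono-≤ : {F G : Vector ℕ m} → (∀ z → F z ≤ G z) → ∑ F ≤ ∑ G
∑-mono-≤ {zero}  F≤G = z≤n
∑-mono-≤ {suc m} F≤G = ℕ.+-mono-≤ (F≤G zero) (∑-mono-≤ (F≤G ∘ suc))

∑-*ˡ : ∀ k (F : Vector ℕ m) → ∑ (λ z → k * F z) ≡ k * ∑ F
∑-*ˡ {zero}  k F = sym (ℕ.*-zeroʳ k)
∑-*ˡ {suc m} k F = trans (cong (k * F zero +_) (∑-*ˡ k (F ∘ suc))) (sym (ℕ.*-distribˡ-+ k (F zero) _))

∑-∑[]-δ : (g : A → Fin m) (xs : List A) → ∑ (λ z → ∑[] (δ z ∘ g) xs) ≡ length xs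
∑-∑[]-δ {m = m} g []       = ∑-zero m
∑-∑[]-δ g (x ∷ xs) = trans (∑-+ (λ z → δ z (g x)) (λ z → ∑[] (δ z ∘ g) xs))
  (cong₂ _+_ (∑-δ (g x)) (∑-∑[]-δ g xs))

∑-∑₂-δ : (g : A → A → Fin m) (xs : List A) → ∑ (λ z → ∑₂ (λ x → δ z ∘ g x) xs) ≡ tri (length xs)
∑-∑₂-δ {m = m} g []       = ∑-zero m
∑-∑₂-δ g (x ∷ xs) = trans (∑-+ (λ z → ∑[] (δ z ∘ g x) xs) (λ z → ∑₂ (λ x → δ z ∘ g x) xs))
  (cong₂ _+_ (∑-∑[]-δ (g x) xs) (∑-∑₂-δ g xs))

-- Every pair is counted under exactly one label, so the total is the number of pairs not inside
-- `N`.
∑-∑₂-outside-δ : (g : A → A → Fin m) (N xs : List A) →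
  ∑ (λ z → ∑₂-outside (λ x → δ z ∘ g x) N xs) ≡ length N * length xs + tri (length xs)
∑-∑₂-outside-δ g []      xs = ∑-∑₂-δ g xs
∑-∑₂-outside-δ g (x ∷ N) xs = trans
  (∑-+ (λ z → ∑[] (δ z ∘ g x) xs) (λ z → ∑₂-outside (λ x → δ z ∘ g x) N xs))
  (trans (cong₂ _+_ (∑-∑[]-δ (g x) xs) (∑-∑₂-outside-δ g N xs))
    (sym (ℕ.+-assoc (length xs) _ _)))

-- Two deck-equivalent multisets of labels

tri≤square : ∀ n → tri n ≤ n * n
tri≤square zero    = z≤n
tri≤square (suc n) = begin
  n + tri n              ≤⟨ ℕ.+-monoʳ-≤ n (tri≤square n) ⟩
  n + n * n              ≤⟨ ℕ.+-mono-≤ (ℕ.n≤1+n n) (ℕ.*-monoʳ-≤ n (ℕ.n≤1+n n)) ⟩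
  suc n + n * suc n      ∎
  where open ℕ.≤-Reasoning

n≤tri : 3 ≤ n → n ≤ tri n
n≤tri {suc (suc (suc n))} (s≤s (s≤s (s≤s z≤n))) = s≤s (s≤s (begin
  suc n                               ≡⟨ ℕ.+-comm 1 n ⟩
  n + 1                               ≤⟨ ℕ.+-monoʳ-≤ n (s≤s z≤n) ⟩
  n + suc (n + (n + tri n))           ∎))
  where open ℕ.≤-Reasoning

tri≤n⇒n≡3 : 3 ≤ n → tri n ≤ n → n ≡ 3
tri≤n⇒n≡3 {suc (suc (suc zero))} (s≤s (s≤s (s≤s z≤n))) _ = refl
tri≤n⇒n≡3 {suc (suc (suc (suc n)))} (s≤s (s≤s (s≤s z≤n))) (s≤s (s≤s (s≤s le))) = contradiction (begin-strict
  suc n                   <⟨ ℕ.n≤1+n (2 + n) ⟩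
  3 + n                   ≤⟨ n≤tri {3 + n} (s≤s (s≤s (s≤s z≤n))) ⟩
  tri (3 + n)             ≤⟨ ℕ.m≤n+m _ n ⟩
  n + tri (3 + n)         ≤⟨ le ⟩
  suc n                   ∎) (ℕ.<-irrefl refl)
  where open ℕ.≤-Reasoning

-- Here `r` is the size of the common part and `k` that of each remainder; the right side of the
-- inequality is the number of pairs that meet the remainder.
few-differences : ∀ r k → 3 ≤ n → r + k ≡ suc n → tri n * k ≤ r * k + tri k →
                  k ≡ 0 ⊎ (k ≡ 1 × r ≡ 3 × n ≡ 3)
few-differences r zero _ _ _ = inj₁ refl
few-differences {n} r (suc k) 3≤n eq le with ℕ.suc-injective (trans (sym (ℕ.+-suc r k)) eq)
-- With `k` now the predecessor and `n = r + k`, weakening `tri n` to `n` and cancelling leaves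
-- `k * k ≤ tri k`, which fails for positive `k`.
... | refl with ℕ.+-cancelˡ-≤ k _ _ (ℕ.+-cancelˡ-≤ (r * suc k) _ _ (begin
    r * suc k + (k + k * k)  ≡⟨ cong (r * suc k +_) (ℕ.*-suc k k) ⟨
    r * suc k + k * suc k    ≡⟨ ℕ.*-distribʳ-+ (suc k) r k ⟨
    (r + k) * suc k          ≤⟨ ℕ.*-monoˡ-≤ (suc k) (n≤tri 3≤n) ⟩
    tri (r + k) * suc k      ≤⟨ le ⟩
    r * suc k + (k + tri k)  ∎))
    where open ℕ.≤-Reasoning
few-differences {n} r (suc zero) 3≤n eq le | refl | _ =
  inj₂ (refl , trans (sym (ℕ.+-identityʳ r)) n≡3 , n≡3)
  where
  n≡3 : r + 0 ≡ 3
  n≡3 = tri≤n⇒n≡3 3≤n (begin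
    tri (r + 0)       ≡⟨ ℕ.*-identityʳ _ ⟨
    tri (r + 0) * 1   ≤⟨ le ⟩
    r * 1 + 0         ≡⟨ cong (_+ 0) (ℕ.*-identityʳ r) ⟩
    r + 0             ∎)
    where open ℕ.≤-Reasoning
few-differences {n} r (suc (suc j)) 3≤n eq le | refl | square≤tri = contradiction (begin-strict
  suc j * suc j   ≤⟨ square≤tri ⟩
  j + tri j       ≤⟨ ℕ.+-monoʳ-≤ j (tri≤square j) ⟩
  j + j * j       ≡⟨ ℕ.*-suc j j ⟨
  j * suc j       <⟨ ℕ.m<n+m (j * suc j) (s≤s z≤n) ⟩
  suc j * suc j   ∎) (ℕ.<-irrefl refl)
  where open ℕ.≤-Reasoning

module _ {A : Set} (ℓ : A → Fin m) where

  private
    -- Elements are compared by label only, so `_↭_` is equality of multisets of labels.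
    S : Setoid _ _
    S = On.setoid (≡ₚ.setoid (Fin m)) ℓ
  open SetoidPermutation S using (_↭_; ↭-refl; ↭-sym; ↭-trans; prep; ↭-prep; ↭-swap)
  open SetoidPermutationₚ S using (↭-shift; ++⁺ˡ; xs↭ys⇒|xs|≡|ys|)

  multiplicity : Fin m → List A → ℕ
  multiplicity z = ∑[] (δ z ∘ ℓ)

  multiplicity-↭ : ∀ z {xs ys} → xs ↭ ys → multiplicity z xs ≡ multiplicity z ys
  multiplicity-↭ z = ∑[]-↭ (cong (δ z))

  extract : ∀ x ys → (∃[ zs ] ys ↭ x ∷ zs) ⊎ multiplicity (ℓ x) ys ≡ 0
  extract x [] = inj₂ refl
  extract x (y ∷ ys) with ℓ x Finₚ.≟ ℓ y
  ... | yes x≈y = inj₁ (ys , prep (sym x≈y) ↭-refl)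
  ... | no _ with extract x ys
  ...   | inj₁ (zs , p) = inj₁ (y ∷ zs , ↭-trans (↭-prep y p) (↭-swap y x ↭-refl))
  ...   | inj₂ eq       = inj₂ eq

  Disjoint : List A → List A → Set
  Disjoint xs ys = ∀ z → multiplicity z xs ≡ 0 ⊎ multiplicity z ys ≡ 0

  -- Greedy matching: each entry of `xs` is either cancelled against an equally labelled entry left
  -- in `ys′` or, if there is none, put into the remainder.
  common-part : ∀ xs ys → ∃[ N ] ∃[ xs′ ] ∃[ ys′ ] xs ↭ N ++ₗ xs′ × ys ↭ N ++ₗ ys′ × Disjoint xs′ ys′
  common-part [] ys = [] , [] , ys , ↭-refl , ↭-refl , λ z → inj₁ refl
  common-part (x ∷ xs) ys with common-part xs ys
  ... | N , xs′ , ys′ , p , q , disjoint with extract x ys′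
  ...   | inj₁ (zs , e) = x ∷ N , xs′ , zs , ↭-prep x p , ↭-trans q (↭-trans (++⁺ˡ N e) (↭-shift N zs)) ,
          λ z → Sum.map₂ (λ none → ℕ.m+n≡0⇒n≡0 (δ z (ℓ x)) (trans (sym (multiplicity-↭ z e)) none)) (disjoint z)
  ...   | inj₂ none = N , x ∷ xs′ , ys′ , ↭-trans (↭-prep x p) (↭-sym (↭-shift N xs′)) , q , disjoint′
    where
    disjoint′ : Disjoint (x ∷ xs′) ys′
    disjoint′ z with z Finₚ.≟ ℓ x
    ... | yes refl = inj₂ none
    ... | no  _    = disjoint z

  module _ (_∙_ : A → A → Fin m) where

    -- The one way in which different multisets can have the same counts.
    Twisted : List A → List A → Set
    Twisted xs ys = ∃[ u ] ∃[ v ] ∃[ w ] ∃[ a ] ∃[ b ]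
      xs ↭ u ∷ v ∷ w ∷ a ∷ [] × ys ↭ u ∷ v ∷ w ∷ b ∷ [] ×
      (ℓ a ≡ u ∙ b × ℓ a ≡ v ∙ b × ℓ a ≡ w ∙ b) × (ℓ b ≡ u ∙ a × ℓ b ≡ v ∙ a × ℓ b ≡ w ∙ a)

    private
      sum-is : Fin m → A → A → ℕ
      sum-is z x y = δ z (x ∙ y)

      -- If `z` is absent from `xs`, the left side is 0. Otherwise it is absent from `ys`; once the
      -- contribution of `N` cancels, only pairs outside `N` can supply the count on the `ys` side.
      outside-bound : ∀ k N xs ys → Disjoint xs ys →
        (∀ z → k * multiplicity z (N ++ₗ xs) + ∑₂ (sum-is z) (N ++ₗ xs) ≡
               k * multiplicity z (N ++ₗ ys) + ∑₂ (sum-is z) (N ++ₗ ys)) →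
        ∀ z → k * multiplicity z xs ≤ ∑₂-outside (sum-is z) N ys
      outside-bound k N xs ys disjoint eq z with disjoint z
      ... | inj₁ none rewrite none = ℕ.≤-trans (ℕ.≤-reflexive (ℕ.*-zeroʳ k)) z≤n
      ... | inj₂ none = begin
        k * multiplicity z xs                                      ≤⟨ ℕ.m≤m+n _ _ ⟩
        k * multiplicity z xs + ∑₂-outside (sum-is z) N xs         ≡⟨ ℕ.+-cancelˡ-≡ (k * multiplicity z N + ∑₂ (sum-is z) N) _ _ balance ⟩
        k * multiplicity z ys + ∑₂-outside (sum-is z) N ys         ≡⟨ cong (λ c → k * c + ∑₂-outside (sum-is z) N ys) none ⟩
        k * 0 + ∑₂-outside (sum-is z) N ys                         ≡⟨ cong (_+ ∑₂-outside (sum-is z) N ys) (ℕ.*-zeroʳ k) ⟩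
        ∑₂-outside (sum-is z) N ys                                 ∎
        where
        open ℕ.≤-Reasoning
        regroup : ∀ k a b c d → k * a + c + (k * b + d) ≡ k * (a + b) + (c + d)
        regroup = solve-∀
        split : ∀ xs → k * multiplicity z N + ∑₂ (sum-is z) N + (k * multiplicity z xs + ∑₂-outside (sum-is z) N xs) ≡
                       k * multiplicity z (N ++ₗ xs) + ∑₂ (sum-is z) (N ++ₗ xs)
        split xs = trans (regroup k _ _ _ _)
          (sym (cong₂ (λ s t → k * s + t) (∑[]-++ (δ z ∘ ℓ) N xs) (∑₂-++ (sum-is z) N xs)))
        balance : k * multiplicity z N + ∑₂ (sum-is z) N + (k * multiplicity z xs + ∑₂-outside (sum-is z) N xs) ≡
                  k * multiplicity z N + ∑₂ (sum-is z) N + (k * multiplicity z ys + ∑₂-outside (sum-is z) N ys)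
        balance = trans (split xs) (trans (eq z) (sym (split ys)))

      -- The sum has the shape to which `∑₂-outside` unfolds for three common entries and one other.
      all-one : ∀ {x y z} → x ≤ 1 → y ≤ 1 → z ≤ 1 → 3 ≤ x + 0 + (y + 0 + (z + 0 + 0)) →
                1 ≤ x × 1 ≤ y × 1 ≤ z
      all-one (s≤s z≤n) (s≤s z≤n) (s≤s z≤n) _ = s≤s z≤n , s≤s z≤n , s≤s z≤n
      all-one z≤n       (s≤s z≤n) (s≤s z≤n) (s≤s (s≤s ()))
      all-one z≤n       z≤n       (s≤s z≤n) (s≤s ())
      all-one z≤n       (s≤s z≤n) z≤n       (s≤s ())
      all-one (s≤s z≤n) z≤n       (s≤s z≤n) (s≤s (s≤s ()))
      all-one (s≤s z≤n) (s≤s z≤n) z≤n       (s≤s (s≤s ()))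
      all-one (s≤s z≤n) z≤n       z≤n       (s≤s ())

      saturated : ∀ u v w a b → 3 * (δ (ℓ a) (ℓ a) + 0) ≤ ∑₂-outside (sum-is (ℓ a)) (u ∷ v ∷ w ∷ []) (b ∷ []) →
                  ℓ a ≡ u ∙ b × ℓ a ≡ v ∙ b × ℓ a ≡ w ∙ b
      saturated u v w a b le rewrite δ-refl (ℓ a)
        with all-one (δ≤1 (ℓ a) (u ∙ b)) (δ≤1 (ℓ a) (v ∙ b)) (δ≤1 (ℓ a) (w ∙ b)) le
      ... | x , y , z = 1≤δ⇒≡ x , 1≤δ⇒≡ y , 1≤δ⇒≡ z

      outside-cases : 3 ≤ n → ∀ N xs ys → length N + length xs ≡ suc n → length xs ≡ length ys →
        (∀ z → tri n * multiplicity z xs ≤ ∑₂-outside (sum-is z) N ys) →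
        (∀ z → tri n * multiplicity z ys ≤ ∑₂-outside (sum-is z) N xs) →
        (N ++ₗ xs ↭ N ++ₗ ys) ⊎ Twisted (N ++ₗ xs) (N ++ₗ ys)
      outside-cases {n} 3≤n N xs ys |N++xs| |xs|≡|ys| xs-bound ys-bound
        -- Summing `xs-bound` over all labels turns it into an inequality between lengths.
        with few-differences (length N) (length xs) 3≤n |N++xs| (begin
          tri n * length xs                               ≡⟨ cong (tri n *_) (∑-∑[]-δ ℓ xs) ⟨
          tri n * ∑ (λ z → multiplicity z xs)             ≡⟨ ∑-*ˡ (tri n) (λ z → multiplicity z xs) ⟨
          ∑ (λ z → tri n * multiplicity z xs)             ≤⟨ ∑-mono-≤ xs-bound ⟩
          ∑ (λ z → ∑₂-outside (sum-is z) N ys)            ≡⟨ ∑-∑₂-outside-δ _∙_ N ys ⟩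
          length N * length ys + tri (length ys)          ≡⟨ cong (λ k → length N * k + tri k) |xs|≡|ys| ⟨
          length N * length xs + tri (length xs)          ∎)
        where open ℕ.≤-Reasoning
      outside-cases 3≤n N [] [] _ _ _ _ | inj₁ _ = inj₁ ↭-refl
      -- As `tri 3 = 3`, the label of `a` needs three pairs, and just three pairs join `b` to the
      -- common part; hence all of them have this label. The same holds with `a` and `b` exchanged.
      outside-cases 3≤n (u ∷ v ∷ w ∷ []) (a ∷ []) (b ∷ []) _ _ xs-bound ys-bound | inj₂ (refl , refl , refl) =
        inj₂ (u , v , w , a , b , ↭-refl , ↭-refl ,
              saturated u v w a b (xs-bound (ℓ a)) , saturated u v w b a (ys-bound (ℓ b)))

    -- Congruence and commutativity of `_∙_` make the counts invariant under `_↭_`, so both lists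
    -- may be rearranged to begin with their common part.
    ↭-or-Twisted :
      (∀ {x x′} y → ℓ x ≡ ℓ x′ → x ∙ y ≡ x′ ∙ y) → (∀ x y → x ∙ y ≡ y ∙ x) →
      3 ≤ n → ∀ xs ys → length xs ≡ suc n → length ys ≡ suc n →
      (∀ z → tri n * multiplicity z xs + ∑₂ (λ x y → δ z (x ∙ y)) xs ≡
             tri n * multiplicity z ys + ∑₂ (λ x y → δ z (x ∙ y)) ys) →
      xs ↭ ys ⊎ Twisted xs ys
    ↭-or-Twisted {n} ∙-congˡ ∙-comm 3≤n xs ys |xs| |ys| eq
      with common-part xs ys
    ... | N , xs′ , ys′ , p , q , disjoint =
      Sum.map (λ r → ↭-trans p (↭-trans r (↭-sym q)))
              (λ (u , v , w , a , b , r , s , t) → u , v , w , a , b , ↭-trans p r , ↭-trans q s , t)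
              (outside-cases 3≤n N xs′ ys′ |N++xs′| (ℕ.+-cancelˡ-≡ (length N) _ _ (trans |N++xs′| (sym |N++ys′|)))
                (outside-bound (tri n) N xs′ ys′ disjoint eq′)
                (outside-bound (tri n) N ys′ xs′ (Sum.swap ∘ disjoint) (sym ∘ eq′)))
      where
      |N++xs′| : length N + length xs′ ≡ suc n
      |N++xs′| = trans (sym (Listₚ.length-++ N)) (trans (sym (xs↭ys⇒|xs|≡|ys| p)) |xs|)
      |N++ys′| : length N + length ys′ ≡ suc n
      |N++ys′| = trans (sym (Listₚ.length-++ N)) (trans (sym (xs↭ys⇒|xs|≡|ys| q)) |ys|)
      count-↭ : ∀ z {xs ys} → xs ↭ ys →
                tri n * multiplicity z xs + ∑₂ (sum-is z) xs ≡ tri n * multiplicity z ys + ∑₂ (sum-is z) ys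
      count-↭ z r = cong₂ (λ s t → tri n * s + t) (multiplicity-↭ z r)
        (∑₂-↭ (λ y e → cong (δ z) (∙-congˡ y e)) (λ x y → cong (δ z) (∙-comm x y)) r)
      eq′ : ∀ z → tri n * multiplicity z (N ++ₗ xs′) + ∑₂ (sum-is z) (N ++ₗ xs′) ≡
                  tri n * multiplicity z (N ++ₗ ys′) + ∑₂ (sum-is z) (N ++ₗ ys′)
      eq′ z = trans (sym (count-↭ z p)) (trans (eq z) (count-↭ z q))

-- Exhaustive search

Searchable : Set → Set₁
Searchable I = {P : I → Set} → Decidable P → Dec (∃ P)

_⊎-search_ : {I J : Set} → Searchable I → Searchable J → Searchable (I ⊎ J)
(searchᵢ ⊎-search searchⱼ) P? = map′
  [ (λ (i , p) → inj₁ i , p) , (λ (j , p) → inj₂ j , p) ]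
  (λ { (inj₁ i , p) → inj₁ (i , p) ; (inj₂ j , p) → inj₂ (j , p) })
  (searchᵢ (P? ∘ inj₁) ⊎-dec searchⱼ (P? ∘ inj₂))

Σ-search : {I : Set} {J : I → Set} → Searchable I → (∀ i → Searchable (J i)) → Searchable (Σ[ i ∈ I ] J i)
Σ-search searchᵢ searchⱼ P? = map′
  (λ (i , j , p) → (i , j) , p) (λ ((i , j) , p) → i , j , p)
  (searchᵢ (λ i → searchⱼ i (λ j → P? (i , j))))

-- The condition `C` accommodates conditional laws such as congruence. Failure yields an explicit
-- instance, from which a new equation can be read off.
all-or-counterexample : {I : Set} → Searchable I → {C D : I → Set} → Decidable C → Decidable D →
                        (∀ i → C i → D i) ⊎ (∃[ i ] C i × ¬ D i)
all-or-counterexample search C? D? with search (λ i → C? i ×-dec ¬? (D? i))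
... | yes (i , c , ¬d) = inj₂ (i , c , ¬d)
... | no  none         = inj₁ λ i c → decidable-stable (D? i) (λ ¬d → none (i , c , ¬d))

-- Labellings of a finite set of expressions

module _ (S : Setoid c ℓ) {X : Set} (value : X → Setoid.Carrier S) where

  open Setoid S using (_≈_) renaming (refl to ≈-refl; sym to ≈-sym; trans to ≈-trans)

  Sound : (X → Fin m) → Set _
  Sound label = ∀ {t u} → label t ≡ label u → value t ≈ value u

  NewEquation : (X → Fin m) → Set _
  NewEquation label = ∃[ t ] ∃[ u ] label t ≢ label u × value t ≈ value u

  -- Terms labelled like `u` take over the label of `t`. The label of `u` is then vacant and can be
  -- punched out, so the number of labels drops by one.
  identify : (label : X → Fin (suc m)) → Sound label → NewEquation label →
             Σ[ label′ ∈ (X → Fin m) ] Sound label′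
  identify {m} label sound (t , u , t≢u , t≈u) = label′ , sound′
    where
    representative : ∀ s → Σ[ r ∈ X ] label u ≢ label r × value r ≈ value s
    representative s with label u Finₚ.≟ label s
    ... | yes u≡s = t , t≢u ∘ sym , ≈-trans t≈u (sound u≡s)
    ... | no  u≢s = s , u≢s , ≈-refl
    label′ : X → Fin m
    label′ s = punchOut (proj₁ (proj₂ (representative s)))
    sound′ : Sound label′
    sound′ {s} {s′} eq = ≈-trans (≈-sym (proj₂ (proj₂ (representative s))))
      (≈-trans (sound (Finₚ.punchOut-injective (proj₁ (proj₂ (representative s))) (proj₁ (proj₂ (representative s′))) eq))
               (proj₂ (proj₂ (representative s′))))

  -- Replaces a case distinction on the (undecidable) equality of values: a labelling
  -- that is too fine to be of use reveals an equation by which it can be coarsened.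
  saturate : {Goal : Set p} →
             (∀ {m} (label : X → Fin m) → Sound label → Goal ⊎ NewEquation label) →
             (label : X → Fin m) → Sound label → Goal
  saturate step label sound with step label sound
  ... | inj₁ goal = goal
  saturate {m = zero}  step label sound | inj₂ (t , _) with () ← label t
  saturate {m = suc m} step label sound | inj₂ new =
    let label′ , sound′ = identify label sound new in saturate step label′ sound′

some-pair : 1 ≤ n → Pair (suc n)
some-pair (s≤s z≤n) = suc zero , zero

-- Reconstruction of vectors over a commutative monoid

↭⇒permutation : (S : Setoid c ℓ) (let open Setoid S; open SetoidPermutation S using (_↭_)) →
                (f g : Vector Carrier n) → tabulate f ↭ tabulate g →
                Σ[ σ ∈ Permutation′ n ] (∀ i → f i ≈ g (σ ⟨$⟩ʳ i))
↭⇒permutation {n = n} S f g f↭g = castᶠ ∘ₚ (π ∘ₚ flip castᵍ) , λ i →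
  ≈-trans (reflexive (sym (Listₚ.lookup-tabulate f i)))
    (≈-trans (SetoidPermutationₚ.onIndices-lookup S f↭g (castᶠ ⟨$⟩ʳ i))
      (reflexive (trans (cong (lookup (tabulate g)) (sym (inverseʳ castᵍ)))
                        (Listₚ.lookup-tabulate g _))))
  where
  open Setoid S using (reflexive) renaming (trans to ≈-trans)
  π = Homogeneous.onIndices f↭g
  castᶠ : Permutation n (length (tabulate f))
  castᶠ = cast-id (sym (Listₚ.length-tabulate f))
  castᵍ : Permutation n (length (tabulate g))
  castᵍ = cast-id (sym (Listₚ.length-tabulate g))

module _ (M : CommutativeMonoid c ℓ) where

  open CommutativeMonoid M renaming
    (_∙_ to _⊕_; refl to ≈-refl; sym to ≈-sym; trans to ≈-trans; ∙-cong to ⊕-cong; ∙-congˡ to ⊕-congˡ; ∙-congʳ to ⊕-congʳ)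
  open MonoidSum M using (sum; sum-remove; sum-cong-≋; sum-permute)
  open import Relation.Binary.Reasoning.Setoid setoid

  evaluate : (W → Carrier) → Term W → Carrier
  evaluate v = [ v , (λ (x , y) → v x ⊕ v y) ]

  -- Cards are natural in their entries; this links cards of positions, which get labels, to cards
  -- of coefficients.
  evaluate-card : (v : W → Carrier) (w : Vector W (suc n)) (p : Pair (suc n)) → ∀ k →
                  evaluate v (card w p k) ≡ evaluate (v ∘ w) (card id p k)
  evaluate-card v w p k with k Finₚ.≟ inject! (proj₂ p)
  ... | yes refl = trans (cong (evaluate v) (card-merged w p)) (sym (cong (evaluate (v ∘ w)) (card-merged id p)))
  ... | no  k≢i  = trans (cong (evaluate v) (card-other w p k k≢i)) (sym (cong (evaluate (v ∘ w)) (card-other id p k k≢i)))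

  sum-card : (α : Vector Carrier (suc n)) (p : Pair (suc n)) → sum (evaluate α ∘ card id p) ≈ sum α
  sum-card α p@(j , i) = begin
    sum (evaluate α ∘ card id p)      ≈⟨ identityʳ _ ⟨
    sum (evaluate α ∘ card id p) ⊕ ε  ≈⟨ sum-change M (evaluate α ∘ card id p) (removeAt α j) (inject! i)
      (≈-trans (identityʳ _) (reflexive (cong (evaluate α) (card-merged id p))))
      (λ k k≢i → reflexive (cong (evaluate α) (card-other id p k k≢i))) ⟩
    sum (removeAt α j) ⊕ α j          ≈⟨ comm _ _ ⟩
    α j ⊕ sum (removeAt α j)          ≈⟨ sum-remove {i = j} α ⟨
    sum α                             ∎

  SameCards : (α β : Vector Carrier (suc n)) → Set ℓ
  SameCards {n} α β =
    Σ[ φ ∈ Pair (suc n) ↔ Pair (suc n) ] (∀ p → Σ[ τ ∈ Permutation′ n ]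
      (∀ k → evaluate α (card id p k) ≈ evaluate β (card id (Inverse.to φ p) (τ ⟨$⟩ʳ k))))

  -- Any one card already determines the total. This equation excludes the twisted case.
  SameCards⇒sum-≈ : (α β : Vector Carrier (suc n)) → Pair (suc n) → SameCards α β → sum α ≈ sum β
  SameCards⇒sum-≈ α β p (φ , same) = begin
    sum α                                               ≈⟨ sum-card α p ⟨
    sum (evaluate α ∘ card id p)                        ≈⟨ sum-cong-≋ (proj₂ (same p)) ⟩
    sum (evaluate β ∘ card id q ∘ (proj₁ (same p) ⟨$⟩ʳ_)) ≈⟨ sum-permute (evaluate β ∘ card id q) (proj₁ (same p)) ⟨
    sum (evaluate β ∘ card id q)                        ≈⟨ sum-card β q ⟩
    sum β                                               ∎
    where q = Inverse.to φ p

  module _ (3≤n : 3 ≤ n) (α β : Vector Carrier (suc n)) (deck-≈ : SameCards α β) where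

    private
      φ = proj₁ deck-≈

      τ : Pair (suc n) → Permutation′ n
      τ p = proj₁ (proj₂ deck-≈ p)

      -- Positions in `α` and `β` rather than values: positions are finite in number and can be
      -- searched.
      I : Set
      I = Fin (suc n) ⊎ Fin (suc n)

      v : I → Carrier
      v = [ α , β ]

      value : Term I → Carrier
      value = evaluate v

      V : Setoid _ _
      V = On.setoid setoid v

      open SetoidPermutation V using (_↭_; ↭-refl; ↭-sym; ↭-trans; prep; ↭-prep; ↭-reflexive)

      xs ys : List I
      xs = tabulate inj₁
      ys = tabulate inj₂

      total : List I → Carrier
      total = foldr _⊕_ ε ∘ map v

      total-↭ : ∀ {zs zs′} → zs ↭ zs′ → total zs ≈ total zs′
      total-↭ = SetoidPermutationₚ.foldr-commMonoid setoid isCommutativeMonoid ∘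
                SetoidPermutationₚ.map⁺ V setoid id

      total-tabulate : ∀ {n} (w : Vector I n) → total (tabulate w) ≡ sum (v ∘ w)
      total-tabulate {zero}  w = refl
      total-tabulate {suc n} w = cong (v (w zero) ⊕_) (total-tabulate (w ∘ suc))

      totals : total xs ≈ total ys
      totals = ≈-trans (reflexive (total-tabulate inj₁))
        (≈-trans (SameCards⇒sum-≈ α β (some-pair (ℕ.≤-trans (s≤s z≤n) 3≤n)) deck-≈) (reflexive (sym (total-tabulate inj₂))))

      searchᵢ : Searchable I
      searchᵢ = Finₚ.any? ⊎-search Finₚ.any?

      search-deck : Searchable (Pair (suc n) × Fin n)
      search-deck = Σ-search (Σ-search Finₚ.any? (λ _ → Finₚ.any?)) (λ _ → Finₚ.any?)

      module _ {m} (label : Term I → Fin m) where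

        ℓ′ : I → Fin m
        ℓ′ = label ∘ inj₁

        _∙_ : I → I → Fin m
        x ∙ y = label (inj₂ (x , y))

        -- By `∑-deck`, each side counts the label `z` in all cards of one vector, and the deck
        -- bijection matches these cards.
        same-labels : (∀ p k → label (card inj₁ p k) ≡ label (card inj₂ (Inverse.to φ p) (τ p ⟨$⟩ʳ k))) →
          ∀ z → tri n * multiplicity ℓ′ z xs + ∑₂ (λ x y → δ z (x ∙ y)) xs ≡
                tri n * multiplicity ℓ′ z ys + ∑₂ (λ x y → δ z (x ∙ y)) ys
        same-labels eq z = trans (count inj₁) (trans cards (sym (count inj₂)))
          where
          h : Term I → ℕ
          h = δ z ∘ label
          count : (w : Vector I (suc n)) →
                  tri n * multiplicity ℓ′ z (tabulate w) + ∑₂ (λ x y → δ z (x ∙ y)) (tabulate w) ≡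
                  ∑ₚ (suc n) (λ p → ∑ (h ∘ card w p))
          count w = trans (cong₂ (λ s t → tri n * s + t) (∑[]-tabulate (δ z ∘ ℓ′) w)
                                 (∑₂-tabulate (λ x y → δ z (x ∙ y)) w))
                          (sym (∑-deck h w))
          cards : ∑ₚ (suc n) (λ p → ∑ (h ∘ card inj₁ p)) ≡ ∑ₚ (suc n) (λ p → ∑ (h ∘ card inj₂ p))
          cards = trans
            (∑ₚ-cong (suc n) (λ p → trans (∑-cong (cong (δ z) ∘ eq p))
              (sym (∑-permute (h ∘ card inj₂ (Inverse.to φ p)) (τ p)))))
            (∑ₚ-permute φ (λ p → ∑ (h ∘ card inj₂ p)))

        untwist : Sound setoid value label → Twisted ℓ′ _∙_ xs ys → xs ↭ ys
        untwist sound (x , y , z , a , b , p , q , (xb , yb , zb) , (xa , ya , za)) =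
          ↭-trans p′ (↭-trans (↭-prep x (↭-prep y (↭-prep z (prep (≈-sym b≈a) ↭-refl)))) (↭-sym q′))
          where
          p′ = Homogeneous.map sound p
          q′ = Homogeneous.map sound q
          b≈a : v b ≈ v a
          -- Expanding alternately `b` as a sum with `a` and `a` as a sum with `b` leads from `b` to
          -- the total of `xs`; the same expansions lead from `a` to the total of `ys`.
          b≈a = begin
            v b                              ≈⟨ sound xa ⟩
            v x ⊕ v a                        ≈⟨ ⊕-congˡ (sound yb) ⟩
            v x ⊕ (v y ⊕ v b)                ≈⟨ ⊕-congˡ (⊕-congˡ (≈-trans (sound za) (⊕-congˡ (≈-sym (identityʳ _))))) ⟩
            v x ⊕ (v y ⊕ (v z ⊕ (v a ⊕ ε)))  ≈⟨ ≈-trans (≈-sym (total-↭ p′)) (≈-trans totals (total-↭ q′)) ⟩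
            v x ⊕ (v y ⊕ (v z ⊕ (v b ⊕ ε)))  ≈⟨ ⊕-congˡ (⊕-congˡ (≈-trans (sound zb) (⊕-congˡ (≈-sym (identityʳ _))))) ⟨
            v x ⊕ (v y ⊕ v a)                ≈⟨ ⊕-congˡ (sound ya) ⟨
            v x ⊕ v b                        ≈⟨ sound xb ⟨
            v a                              ∎

        -- Each law tested on labels is true of the values, so a failing instance is an equation
        -- between differently labelled terms. If no law fails, the counting argument applies.
        step : Sound setoid value label → (xs ↭ ys) ⊎ NewEquation setoid value label
        step sound
          with all-or-counterexample search-deck
                 {C = const ⊤} {D = λ (p , k) → label (card inj₁ p k) ≡ label (card inj₂ (Inverse.to φ p) (τ p ⟨$⟩ʳ k))}
                 (λ _ → yes tt) (λ _ → _ Finₚ.≟ _)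
             | all-or-counterexample (Σ-search searchᵢ (λ _ → searchᵢ))
                 {C = const ⊤} {D = λ (x , y) → x ∙ y ≡ y ∙ x}
                 (λ _ → yes tt) (λ _ → _ Finₚ.≟ _)
             | all-or-counterexample (Σ-search searchᵢ (λ _ → Σ-search searchᵢ (λ _ → searchᵢ)))
                 {C = λ (x , x′ , y) → ℓ′ x ≡ ℓ′ x′} {D = λ (x , x′ , y) → x ∙ y ≡ x′ ∙ y}
                 (λ _ → _ Finₚ.≟ _) (λ _ → _ Finₚ.≟ _)
        ... | inj₂ ((p , k) , _ , ≢) | _ | _ = inj₂ (_ , _ , ≢ , ≈-trans
              (reflexive (evaluate-card v inj₁ p k))
              (≈-trans (proj₂ (proj₂ deck-≈ p) k)
                (reflexive (sym (evaluate-card v inj₂ (Inverse.to φ p) (τ p ⟨$⟩ʳ k))))))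
        ... | _ | inj₂ ((x , y) , _ , ≢) | _ = inj₂ (_ , _ , ≢ , comm (v x) (v y))
        ... | _ | _ | inj₂ ((x , x′ , y) , x≡x′ , ≢) = inj₂ (_ , _ , ≢ , ⊕-congʳ (sound x≡x′))
        ... | inj₁ deck-≡ | inj₁ ∙-comm | inj₁ ∙-congˡ = inj₁
              ([ Homogeneous.map sound , untwist sound ]
                (↭-or-Twisted ℓ′ _∙_ (λ y → ∙-congˡ (_ , _ , y)) (λ x y → ∙-comm (x , y) tt)
                  3≤n xs ys (Listₚ.length-tabulate {n = suc n} inj₁) (Listₚ.length-tabulate {n = suc n} inj₂)
                  (same-labels (λ p k → deck-≡ (p , k) tt))))

      -- The initial labelling: every term gets its own label, so soundness is immediate.
      Term-↔ : Term I ↔ Fin ((suc n + suc n) + (suc n + suc n) * (suc n + suc n))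
      Term-↔ = ↔-sym Finₚ.+↔⊎ ↔-∘ (I-↔ ⊎-↔ (↔-sym Finₚ.*↔× ↔-∘ (I-↔ ×-↔ I-↔)))
        where
        I-↔ : I ↔ Fin (suc n + suc n)
        I-↔ = ↔-sym Finₚ.+↔⊎

    reconstruct : Σ[ σ ∈ Permutation′ (suc n) ] (∀ k → α k ≈ β (σ ⟨$⟩ʳ k))
    reconstruct = ↭⇒permutation V inj₁ inj₂
      (saturate setoid value step (Inverse.to Term-↔)
        (λ {t} {u} eq → reflexive (cong value (trans (sym (Inverse.strictlyInverseʳ Term-↔ t))
          (trans (cong (Inverse.from Term-↔) eq) (Inverse.strictlyInverseʳ Term-↔ u))))))

-- Affine functions

module _ {c ℓ} (R : NonassociativeRightSemiring c ℓ) where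

  open NonassociativeRightSemiring R renaming (_+_ to _⊕_; _*_ to _⊛_)
  open CommutativeMonoid +-commutativeMonoid using (identityˡ; identityʳ; comm; reflexive)
    renaming (refl to ≈-refl; sym to ≈-sym; trans to ≈-trans; ∙-cong to ⊕-cong; ∙-congˡ to ⊕-congˡ; ∙-congʳ to ⊕-congʳ)
  open MonoidSum +-commutativeMonoid using (sum-remove; sum-cong-≋; sum-permute; sum-replicate-zero)
  open import Relation.Binary.Reasoning.Setoid setoid

  private
    M = +-commutativeMonoid

    _∼_ : Op R n → Op R n → Set (c ⊔ ℓ)
    _∼_ = _≃_ setoid setoid

  dot : Vector Carrier n → Vector Carrier n → Carrier
  dot α x = sum (zipWith _⊛_ α x)

  dot-cong : ∀ {α β x y : Vector Carrier n} → (∀ k → α k ≈ β k) → (∀ k → x k ≈ y k) → dot α x ≈ dot β y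
  dot-cong α≈β x≈y = sum-cong-≋ (λ k → *-cong (α≈β k) (x≈y k))

  dot-zero : (α : Vector Carrier n) → dot α (const 0#) ≈ 0#
  dot-zero {n} α = ≈-trans (sum-cong-≋ (zeroʳ ∘ α)) (sum-replicate-zero n)

  dot-unit : (α x : Vector Carrier n) (k : Fin n) → x k ≡ 1# → (∀ l → l ≢ k → x l ≡ 0#) → dot α x ≈ α k
  dot-unit {suc n} α x k one zeros = begin
    dot α x                                          ≈⟨ sum-remove {i = k} (zipWith _⊛_ α x) ⟩
    α k ⊛ x k ⊕ dot (removeAt α k) (removeAt x k)    ≈⟨ ⊕-cong
      (≈-trans (*-cong ≈-refl (reflexive one)) (*-identityʳ (α k)))
      (≈-trans (dot-cong (λ _ → ≈-refl) (λ l → reflexive (zeros (punchIn k l) (Finₚ.punchInᵢ≢i k l))))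
               (dot-zero (removeAt α k))) ⟩
    α k ⊕ 0#                                         ≈⟨ identityʳ (α k) ⟩
    α k                                              ∎

  unit : Fin n → Vector Carrier n
  unit k l = if does (l Finₚ.≟ k) then 1# else 0#

  unit-diagonal : (k l : Fin n) → l ≡ k → unit k l ≡ 1#
  unit-diagonal k l l≡k rewrite dec-true (l Finₚ.≟ k) l≡k = refl

  unit-off-diagonal : (k l : Fin n) → l ≢ k → unit k l ≡ 0#
  unit-off-diagonal k l l≢k rewrite dec-false (l Finₚ.≟ k) l≢k = refl

  constants-≈ : (α β : Vector Carrier n) {γ δ : Carrier} →
                affineForm R α γ (const 0#) ≈ affineForm R β δ (const 0#) → γ ≈ δ
  constants-≈ α β {γ} {δ} eq = begin
    γ                          ≈⟨ identityˡ γ ⟨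
    0# ⊕ γ                     ≈⟨ ⊕-congʳ (dot-zero α) ⟨
    dot α (const 0#) ⊕ γ       ≈⟨ eq ⟩
    dot β (const 0#) ⊕ δ       ≈⟨ ⊕-congʳ (dot-zero β) ⟩
    0# ⊕ δ                     ≈⟨ identityˡ δ ⟩
    δ                          ∎

  -- Evaluate at the unit vector of `k`; after rearrangement its 1 stands at `σ ⟨$⟩ˡ k`. The
  -- constants stay, since they cannot be cancelled in general.
  coefficients-≈ : (σ : Permutation′ n) (α β : Vector Carrier n) {γ δ : Carrier} →
                   (∀ x → affineForm R α γ x ≈ affineForm R β δ (rearrange (σ ⟨$⟩ʳ_) x)) →
                   ∀ k → α k ⊕ γ ≈ β (σ ⟨$⟩ˡ k) ⊕ δ
  coefficients-≈ σ α β {γ} {δ} eq k = begin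
    α k ⊕ γ                                          ≈⟨ ⊕-congʳ (dot-unit α (unit k) k (unit-diagonal k k refl) (unit-off-diagonal k)) ⟨
    dot α (unit k) ⊕ γ                               ≈⟨ eq (unit k) ⟩
    dot β (rearrange (σ ⟨$⟩ʳ_) (unit k)) ⊕ δ         ≈⟨ ⊕-congʳ (dot-unit β (rearrange (σ ⟨$⟩ʳ_) (unit k)) (σ ⟨$⟩ˡ k)
      (unit-diagonal k _ (inverseʳ σ))
      (λ l l≢ → unit-off-diagonal k _ (λ σl≡k → l≢ (trans (sym (inverseˡ σ)) (cong (σ ⟨$⟩ˡ_) σl≡k))))) ⟩
    β (σ ⟨$⟩ˡ k) ⊕ δ                                 ∎

  -- The argument `xᵢ` occurs at both positions of the pair, and right distributivity merges its two
  -- coefficients into their sum.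
  dot-insertAt : (α : Vector Carrier (suc n)) (p : Pair (suc n)) (x : Vector Carrier n) →
                 dot α (insertAt x (hi p) (x (inject! (proj₂ p)))) ≈ dot (evaluate M α ∘ card id p) x
  dot-insertAt α p@(j , i) x = begin
    dot α x⁺                                          ≈⟨ sum-remove {i = j} (zipWith _⊛_ α x⁺) ⟩
    α j ⊛ x⁺ j ⊕ dot (removeAt α j) (removeAt x⁺ j)   ≈⟨ ⊕-cong
      (*-cong ≈-refl (reflexive (Vectorₚ.insertAt-lookup x j xᵢ)))
      (dot-cong (λ _ → ≈-refl) (reflexive ∘ Vectorₚ.insertAt-punchIn x j xᵢ)) ⟩
    α j ⊛ xᵢ ⊕ dot (removeAt α j) x                   ≈⟨ comm _ _ ⟩
    dot (removeAt α j) x ⊕ α j ⊛ xᵢ                   ≈⟨ sum-change M (zipWith _⊛_ (evaluate M α ∘ card id p) x) (zipWith _⊛_ (removeAt α j) x) (inject! i)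
      (≈-trans (identityʳ _) (≈-trans
        (*-cong (reflexive (cong (evaluate M α) (card-merged id p))) ≈-refl)
        (distribʳ xᵢ (α (lo p)) (α j))))
      (λ k k≢i → *-cong (reflexive (cong (evaluate M α) (card-other id p k k≢i))) ≈-refl) ⟨
    dot (evaluate M α ∘ card id p) x ⊕ 0#             ≈⟨ identityʳ _ ⟩
    dot (evaluate M α ∘ card id p) x                  ∎
    where
    xᵢ = x (inject! i)
    x⁺ = insertAt x j xᵢ

  -- The hypothesis on removing constants covers both cases: zero constants of linear functions, and
  -- cancellation.
  SameDeck⇒≃ : 3 ≤ n → (f g : Op R (suc n)) (α β : Vector Carrier (suc n)) (γ δ : Carrier) →
               (∀ x → f ⟨$⟩ x ≈ affineForm R α γ x) → (∀ x → g ⟨$⟩ x ≈ affineForm R β δ x) →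
               (γ ≈ δ → ∀ {x y} → x ⊕ γ ≈ y ⊕ δ → x ≈ y) →
               SameDeck setoid setoid f g → f ∼ g
  SameDeck⇒≃ {n} 3≤n f g α β γ δ f-affine g-affine cancel (φ , minors) = flip σ , λ x → begin
    f ⟨$⟩ x                                   ≈⟨ f-affine x ⟩
    dot α x ⊕ γ                               ≈⟨ ⊕-cong (dot-cong α≈β (λ k → reflexive (cong x (sym (inverseˡ σ {k}))))) γ≈δ ⟩
    dot (β ∘ (σ ⟨$⟩ʳ_)) (x ∘ (σ ⟨$⟩ˡ_) ∘ (σ ⟨$⟩ʳ_)) ⊕ δ
      ≈⟨ ⊕-congʳ (sum-permute (zipWith _⊛_ β (x ∘ (σ ⟨$⟩ˡ_))) σ) ⟨
    dot β (rearrange (σ ⟨$⟩ˡ_) x) ⊕ δ         ≈⟨ g-affine (rearrange (σ ⟨$⟩ˡ_) x) ⟨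
    g ⟨$⟩ rearrange (σ ⟨$⟩ˡ_) x               ∎
    where
    card-forms : ∀ p x → affineForm R (evaluate M α ∘ card id p) γ x ≈
                         affineForm R (evaluate M β ∘ card id (Inverse.to φ p)) δ (rearrange (proj₁ (minors p) ⟨$⟩ʳ_) x)
    card-forms p x = begin
      dot (evaluate M α ∘ card id p) x ⊕ γ     ≈⟨ ⊕-congʳ (dot-insertAt α p x) ⟨
      dot α (insertAt x (hi p) _) ⊕ γ          ≈⟨ f-affine _ ⟨
      minor setoid setoid f p ⟨$⟩ x            ≈⟨ proj₂ (minors p) x ⟩
      minor setoid setoid g q ⟨$⟩ y            ≈⟨ g-affine _ ⟩
      dot β (insertAt y (hi q) _) ⊕ δ          ≈⟨ ⊕-congʳ (dot-insertAt β q y) ⟩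
      dot (evaluate M β ∘ card id q) y ⊕ δ     ∎
      where
      q = Inverse.to φ p
      y = rearrange (proj₁ (minors p) ⟨$⟩ʳ_) x

    γ≈δ : γ ≈ δ
    γ≈δ = constants-≈ (evaluate M α ∘ card id p₀) (evaluate M β ∘ card id (Inverse.to φ p₀)) (card-forms p₀ (const 0#))
      where p₀ = some-pair (ℕ.≤-trans (s≤s z≤n) 3≤n)

    same-cards : SameCards M α β
    -- Permuting the variables of a form permutes its coefficients by the inverse, hence `flip`.
    same-cards = φ , λ p → flip (proj₁ (minors p)) , λ k →
      cancel γ≈δ (coefficients-≈ (proj₁ (minors p)) _ _ (card-forms p) k)

    σ : Permutation′ (suc n)
    σ = proj₁ (reconstruct M 3≤n α β same-cards)

    α≈β : ∀ k → α k ≈ β (σ ⟨$⟩ʳ k)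
    α≈β = proj₂ (reconstruct M 3≤n α β same-cards)

  linear-SameDeck⇒≃ : n ≥ 4 → (f g : Op R n) → Linear R f → Linear R g → SameDeck setoid setoid f g → f ∼ g
  linear-SameDeck⇒≃ (s≤s 3≤n) f g (α , f-linear) (β , g-linear) =
    SameDeck⇒≃ 3≤n f g α β 0# 0# f-linear g-linear
      (λ _ x≈y → ≈-trans (≈-sym (identityʳ _)) (≈-trans x≈y (identityʳ _)))

  affine-SameDeck⇒≃ : +-Cancellative → n ≥ 4 → (f g : Op R n) → Affine R f → Affine R g →
                      SameDeck setoid setoid f g → f ∼ g
  affine-SameDeck⇒≃ +-cancel (s≤s 3≤n) f g (α , γ , f-affine) (β , δ , g-affine) =
    SameDeck⇒≃ 3≤n f g α β γ δ f-affine g-affine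
      (λ γ≈δ x≈y → +-cancel γ _ _ (≈-trans (comm γ _) (≈-trans x≈y (≈-trans (⊕-congˡ (≈-sym γ≈δ)) (comm _ γ)))))

mainTheorem12 : ∀ {c ℓ : Level} (R : NonassociativeRightSemiring c ℓ) →
    let open NonassociativeRightSemiring R in
    (∀ (n : ℕ) → n ≥ 4 → (f g : Op R n) → Affine R f → Affine R g →
    (Linear R f × Linear R g) ⊎ +-Cancellative →
    SameDeck setoid setoid f g ⇔ _≃_ setoid setoid f g)
    × WeaklyReconstructible setoid setoid (Linear≥4 R)
    × (+-Cancellative → WeaklyReconstructible setoid setoid (Affine≥4 R))
mainTheorem12 R =
  (λ n n≥4 f g f-affine g-affine hyp → mk⇔
    ([ (λ (f-linear , g-linear) → linear-SameDeck⇒≃ R n≥4 f g f-linear g-linear)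
     , (λ +-cancel → affine-SameDeck⇒≃ R +-cancel n≥4 f g f-affine g-affine) ] hyp)
    (≃⇒SameDeck setoid setoid f g)) ,
  (λ f (n≥4 , f-linear) g (_ , g-linear) → linear-SameDeck⇒≃ R n≥4 g f g-linear f-linear) ,
  (λ +-cancel f (n≥4 , f-affine) g (_ , g-affine) → affine-SameDeck⇒≃ R +-cancel n≥4 g f g-affine f-affine)
  where open NonassociativeRightSemiring R using (setoid)
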